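{- For every bipartite graph $H$ on $n$ vertices with maximum degree $\Delta$, $r(H)\le 2^{\Delta+6}n$.
   Context: The Ramsey number $r(H)$ is the least positive integer $N$ such that every two-coloring of the edges of the complete graph $K_N$ contains a monochromatic copy of $H$. -}

module Defs where

open import Data.Nat using (ℕ; _+_; _⊔_)
open import Data.Bool using (Bool; true; false; if_then_else_)
open import Data.Fin using (Fin)
open import Data.List using (List; map; foldr; allFin)
open import Data.Nat.ListAction using (sum)
open import Data.Product using (Σ; _×_)
open import Function.Definitions using (Injective)
open import Relation.Binary.PropositionalEquality using (_≡_; _≢_)

record Graph (n : ℕ) : Set where
  field
    adj   : Fin n → Fin n → Bool
    sym   : ∀ u v → adj u v ≡ adj v u
    loopless : ∀ v → adj v v ≡ false
open Graph public

degree : ∀ {n} → Graph n → Fin n → ℕ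
degree {n} H u = sum (map (λ v → if adj H u v then 1 else 0) (allFin n))

maxDegree : ∀ {n} → Graph n → ℕ
maxDegree {n} H = foldr _⊔_ 0 (map (degree H) (allFin n))

Bipartite : ∀ {n} → Graph n → Set
Bipartite {n} H = Σ (Fin n → Bool) λ side →
  ∀ u v → adj H u v ≡ true → side u ≢ side v

EdgeColouring : ℕ → Set
EdgeColouring N = Σ (Fin N → Fin N → Bool) λ χ → ∀ i j → χ i j ≡ χ j i

MonoCopy : ∀ {n N} → Graph n → (Fin N → Fin N → Bool) → Bool → Set
MonoCopy {n} {N} H χ c = Σ (Fin n → Fin N) λ f →
  Injective _≡_ _≡_ f × (∀ u v → adj H u v ≡ true → χ (f u) (f v) ≡ c)

-- K_N → H : every two-colouring of E(K_N) contains a monochromatic copy of H.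
-- r(H) ≤ N  holds iff  Arrows N H  (the property is monotone in N).
Arrows : ∀ {n} → ℕ → Graph n → Set
Arrows {n} N H = (col : EdgeColouring N) →
  Σ Bool λ c → MonoCopy H (Data.Product.proj₁ col) c

{-# OPTIONS --safe #-}
module Submission where

-- Write D for the maximum degree and N = 2^(D+6) n.  Choose a colour c and a D-tuple t of vertices
-- of K_N uniformly, and let L be the set of vertices joined to all of t in colour c.  Averaging over
-- both colours gives E|L| ≥ N / 2^(D+1) = 32n, while the expected number of D-tuples in L with fewer
-- than n common c-neighbours is at most n^D.  Hence for some (c , t) we have |L| ≥ 16n, and at most a
-- 16^(-D) proportion of the D-tuples of L are bad.
--
-- Rosenfeld's counting method then replaces the local lemma.  Among all maps from V(H) to L let
-- count Q be the number of those that are injective on Q and send no neighbourhood contained in Q to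
-- a bad set.  By induction on Q, count (Q - v) ≤ 2 count Q: at most |Q| / |L| of the maps counted on
-- the left are lost to collisions with v, and, since at most 2^D count (Q - v) maps are good off a
-- given neighbourhood, at most a D 2^D 16^(-D) proportion is lost to bad neighbourhoods through v.
--
-- So some injection f sends every neighbourhood to a set with at least n common c-neighbours.
-- Keeping f on one side of the bipartition and re-choosing the images of the other side one at a
-- time among these common neighbours gives a copy of H in colour c.

open import Defs renaming (sym to adj-sym)
open import Data.Bool using (Bool; true; false; if_then_else_)
import Data.Bool.Properties as Bool
open import Data.Fin using (Fin; zero; suc)
import Data.Fin.Properties as Fin
open import Data.Fin.Subset using (Subset; _∈_; _∉_; _⊆_; _⊂_; _-_; inside; outside; ∣_∣; ⊤)
open import Data.Fin.Subset.Induction using (⊂-wellFounded)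
open import Data.Fin.Subset.Properties
  using (_∈?_; _⊆?_; ∈⊤; drop-there; x∈p∧x≢y⇒x∈p-y; x∈p⇒p-x⊂p; p─q⊆p; ⊆-⊂-trans)
open import Data.List using (List; []; _∷_; _++_; length; map; filter; foldr; allFin)
import Data.List as List
open import Data.List.Properties using (length-tabulate; map-tabulate)
import Data.List.Membership.Propositional as List
open import Data.List.Membership.Propositional.Properties using (∈-allFin)
open import Data.List.Relation.Unary.All using (All; []; _∷_)
import Data.List.Relation.Unary.All as All
import Data.List.Relation.Unary.All.Properties as All
import Data.List.Relation.Unary.Any as Any
open import Data.Nat using (ℕ; zero; suc; _+_; _*_; _^_; _⊔_; _≤_; _<_; z≤n; s≤s; NonZero; _<?_; >-nonZero)
open import Data.Nat.ListAction using (sum)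
open import Data.Nat.Properties
open import Data.Nat.Tactic.RingSolver using (solve-∀)
open import Data.Product using (∃; _×_; _,_; proj₁; proj₂)
open import Data.Sum using (inj₁; inj₂)
open import Data.Vec using (Vec; []; _∷_; lookup; toList; tabulate; _[_]≔_)
import Data.Vec as Vec
import Data.Vec.Functional as Functional
import Data.Vec.Functional.Properties as Functional
import Data.Vec.Properties as Vec
open import Function using (_∘_; case_of_)
open import Function.Definitions using (Injective)
open import Induction.WellFounded using (Acc; acc)
open import Relation.Binary.PropositionalEquality
  using (_≡_; _≢_; refl; sym; trans; cong; cong₂; subst; module ≡-Reasoning)
open import Relation.Nullary using (Dec; yes; no; ¬_; ¬?; _×-dec_; _→-dec_; contradiction)
open import Relation.Unary using (Decidable)

private
  variable
    A B : Set
    P Q R : Set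
    k n : ℕ

-- Finite sums over lists.

∑ : List A → (A → ℕ) → ℕ
∑ xs f = sum (map f xs)

infix 5 ∑
syntax ∑ xs (λ x → e) = ∑[ x ∈ xs ] e

∑-mono : ∀ (xs : List A) {f g : A → ℕ} → (∀ x → f x ≤ g x) → ∑ xs f ≤ ∑ xs g
∑-mono []       h = z≤n
∑-mono (x ∷ xs) h = +-mono-≤ (h x) (∑-mono xs h)

∑-cong : ∀ (xs : List A) {f g : A → ℕ} → (∀ x → f x ≡ g x) → ∑ xs f ≡ ∑ xs g
∑-cong []       h = refl
∑-cong (x ∷ xs) h = cong₂ _+_ (h x) (∑-cong xs h)

∑-+ : ∀ (xs : List A) (f g : A → ℕ) → ∑ xs (λ x → f x + g x) ≡ ∑ xs f + ∑ xs g
∑-+ []       f g = refl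
∑-+ (x ∷ xs) f g = trans (cong (f x + g x +_) (∑-+ xs f g)) (lemma (f x) (g x) (∑ xs f) (∑ xs g))
  where
  lemma : ∀ a b c d → a + b + (c + d) ≡ a + c + (b + d)
  lemma = solve-∀

∑-*ˡ : ∀ (xs : List A) k (f : A → ℕ) → ∑ xs (λ x → k * f x) ≡ k * ∑ xs f
∑-*ˡ []       k f = sym (*-zeroʳ k)
∑-*ˡ (x ∷ xs) k f = trans (cong (k * f x +_) (∑-*ˡ xs k f)) (sym (*-distribˡ-+ k (f x) (∑ xs f)))

∑-*ʳ : ∀ (xs : List A) (f : A → ℕ) k → ∑ xs (λ x → f x * k) ≡ ∑ xs f * k
∑-*ʳ []       f k = refl
∑-*ʳ (x ∷ xs) f k = trans (cong (f x * k +_) (∑-*ʳ xs f k)) (sym (*-distribʳ-+ k (f x) (∑ xs f)))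

∑-const : ∀ (xs : List A) k → ∑ xs (λ _ → k) ≡ length xs * k
∑-const []       k = refl
∑-const (x ∷ xs) k = cong (k +_) (∑-const xs k)

∑-swap : ∀ (xs : List A) (ys : List B) (f : A → B → ℕ) →
  ∑ xs (λ x → ∑ ys (f x)) ≡ ∑ ys (λ y → ∑ xs (λ x → f x y))
∑-swap []       ys f = sym (trans (∑-const ys 0) (*-zeroʳ (length ys)))
∑-swap (x ∷ xs) ys f = trans (cong (∑ ys (f x) +_) (∑-swap xs ys f))
                             (sym (∑-+ ys (f x) (λ y → ∑ xs (λ x → f x y))))

∑-++ : ∀ (xs ys : List A) (f : A → ℕ) → ∑ (xs ++ ys) f ≡ ∑ xs f + ∑ ys f
∑-++ []       ys f = refl
∑-++ (x ∷ xs) ys f = trans (cong (f x +_) (∑-++ xs ys f)) (sym (+-assoc (f x) (∑ xs f) (∑ ys f)))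

∑-map : ∀ (h : A → B) (xs : List A) (f : B → ℕ) → ∑ (map h xs) f ≡ ∑ xs (f ∘ h)
∑-map h []       f = refl
∑-map h (x ∷ xs) f = cong (f (h x) +_) (∑-map h xs f)

-- The averaging principle behind every existence step: the colour and tuple, the good map and the
-- fresh vertex are all extracted from a strict comparison of sums.
∑-<⇒∃ : ∀ (xs : List A) {f g : A → ℕ} → ∑ xs f < ∑ xs g → ∃ λ x → f x < g x
∑-<⇒∃ (x ∷ xs) {f} {g} h with f x <? g x
... | yes p = x , p
... | no ¬p = ∑-<⇒∃ xs (+-cancelˡ-< (f x) _ _
                (<-≤-trans h (+-monoˡ-≤ (∑ xs g) (≮⇒≥ ¬p))))

∑-member : ∀ {xs : List A} (f : A → ℕ) {x} → x List.∈ xs → f x ≤ ∑ xs f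
∑-member f (Any.here refl) = m≤m+n _ _
∑-member f (Any.there x∈)  = ≤-trans (∑-member f x∈) (m≤n+m _ _)

-- Writing `length xs` as a sum over `y` allows `g x` to be replaced by `g y`, after which the
-- double sum factors. This is independence at a single coordinate that one of the factors ignores.
∑-*-constʳ : ∀ (xs : List A) (f g : A → ℕ) → (∀ x y → g x ≡ g y) →
  ∑ xs (λ x → f x * g x) * length xs ≡ ∑ xs f * ∑ xs g
∑-*-constʳ xs f g h = begin
  ∑ xs (λ x → f x * g x) * length xs         ≡⟨ *-comm _ (length xs) ⟩
  length xs * ∑ xs (λ x → f x * g x)         ≡⟨ ∑-const xs _ ⟨
  ∑ xs (λ _ → ∑ xs (λ x → f x * g x))        ≡⟨ ∑-cong xs (λ y → ∑-cong xs λ x → cong (f x *_) (h x y)) ⟩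
  ∑ xs (λ y → ∑ xs (λ x → f x * g y))        ≡⟨ ∑-cong xs (λ y → ∑-*ʳ xs f (g y)) ⟩
  ∑ xs (λ y → ∑ xs f * g y)                  ≡⟨ ∑-*ˡ xs (∑ xs f) g ⟩
  ∑ xs f * ∑ xs g                            ∎
  where open ≡-Reasoning

∑-*-constˡ : ∀ (xs : List A) (f g : A → ℕ) → (∀ x y → f x ≡ f y) →
  ∑ xs (λ x → f x * g x) * length xs ≡ ∑ xs f * ∑ xs g
∑-*-constˡ xs f g h = begin
  ∑ xs (λ x → f x * g x) * length xs         ≡⟨ cong (_* length xs) (∑-cong xs λ x → *-comm (f x) (g x)) ⟩
  ∑ xs (λ x → g x * f x) * length xs         ≡⟨ ∑-*-constʳ xs g f h ⟩
  ∑ xs g * ∑ xs f                            ≡⟨ *-comm (∑ xs g) (∑ xs f) ⟩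
  ∑ xs f * ∑ xs g                            ∎
  where open ≡-Reasoning

-- Indicators of decidable propositions.

𝟙 : Dec P → ℕ
𝟙 (yes _) = 1
𝟙 (no  _) = 0

𝟙-yes : (p : Dec P) → P → 𝟙 p ≡ 1
𝟙-yes (yes _) _ = refl
𝟙-yes (no ¬p) p = contradiction p ¬p

𝟙-no : (p : Dec P) → ¬ P → 𝟙 p ≡ 0
𝟙-no (yes p) ¬p = contradiction p ¬p
𝟙-no (no _)  _  = refl

𝟙-≤1 : (p : Dec P) → 𝟙 p ≤ 1
𝟙-≤1 (yes _) = ≤-refl
𝟙-≤1 (no _)  = z≤n

𝟙-≤ : (p : Dec P) → (P → 1 ≤ k) → 𝟙 p ≤ k
𝟙-≤ (yes p) h = h p
𝟙-≤ (no _)  h = z≤n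

𝟙>0⇒ : (p : Dec P) → 0 < 𝟙 p → P
𝟙>0⇒ (yes p) _ = p

𝟙-mono : (p : Dec P) (q : Dec Q) → (P → Q) → 𝟙 p ≤ 𝟙 q
𝟙-mono p q h = 𝟙-≤ p λ x → ≤-reflexive (sym (𝟙-yes q (h x)))

𝟙-cong : (p : Dec P) (q : Dec Q) → (P → Q) → (Q → P) → 𝟙 p ≡ 𝟙 q
𝟙-cong p q f g = ≤-antisym (𝟙-mono p q f) (𝟙-mono q p g)

𝟙-× : (p : Dec P) (q : Dec Q) (r : Dec R) → (P → Q × R) → (Q × R → P) → 𝟙 p ≡ 𝟙 q * 𝟙 r
𝟙-× p (yes q) (yes r) f g = 𝟙-yes p (g (q , r))
𝟙-× p (yes _) (no ¬r) f g = 𝟙-no p (¬r ∘ proj₂ ∘ f)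
𝟙-× p (no ¬q) _       f g = 𝟙-no p (¬q ∘ proj₁ ∘ f)

∑-filter : ∀ {P : A → Set} (P? : Decidable P) xs (f : A → ℕ) →
  ∑ (filter P? xs) f ≡ ∑ xs (λ x → 𝟙 (P? x) * f x)
∑-filter P? []       f = refl
∑-filter P? (x ∷ xs) f with P? x
... | yes _ = cong₂ _+_ (sym (*-identityˡ (f x))) (∑-filter P? xs f)
... | no  _ = ∑-filter P? xs f

length-filter : ∀ {P : A → Set} (P? : Decidable P) xs →
  length (filter P? xs) ≡ ∑ xs (λ x → 𝟙 (P? x))
length-filter P? []       = refl
length-filter P? (x ∷ xs) with P? x
... | yes _ = cong suc (length-filter P? xs)
... | no  _ = length-filter P? xs

∑-allFin-suc : ∀ (f : Fin (suc n) → ℕ) → ∑ (allFin (suc n)) f ≡ f zero + ∑ (allFin n) (f ∘ suc)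
∑-allFin-suc {n} f = cong (f zero +_)
  (trans (cong (λ js → ∑ js f) (sym (map-tabulate {n = n} (λ i → i) suc))) (∑-map suc (allFin n) f))

∑-𝟙-≟ : ∀ (i : Fin n) → ∑ (allFin n) (λ j → 𝟙 (j Fin.≟ i)) ≡ 1
∑-𝟙-≟ {suc n} i = trans (∑-allFin-suc λ j → 𝟙 (j Fin.≟ i)) (go i)
  where
  go : ∀ i → 𝟙 (zero Fin.≟ i) + ∑ (allFin n) (λ j → 𝟙 (suc j Fin.≟ i)) ≡ 1
  go zero    = cong suc (trans (∑-const (allFin n) 0) (*-zeroʳ (length (allFin n))))
  go (suc i) = trans (∑-cong (allFin n) λ j → 𝟙-cong (suc j Fin.≟ suc i) (j Fin.≟ i) Fin.suc-injective (cong suc))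
                     (∑-𝟙-≟ i)

-- Sums over all tuples with entries from a list.

vecs : List A → (n : ℕ) → List (Vec A n)
vecs xs zero    = [] ∷ []
vecs xs (suc n) = List.cartesianProductWith _∷_ xs (vecs xs n)

∑-vecs-suc : ∀ (xs : List A) n (F : Vec A (suc n) → ℕ) →
  ∑ (vecs xs (suc n)) F ≡ ∑ xs (λ x → ∑ (vecs xs n) (λ v → F (x ∷ v)))
∑-vecs-suc xs n F = go xs
  where
  go : ∀ ys → ∑ (List.cartesianProductWith _∷_ ys (vecs xs n)) F ≡ ∑ ys (λ x → ∑ (vecs xs n) (λ v → F (x ∷ v)))
  go []       = refl
  go (y ∷ ys) = trans (∑-++ (map (y ∷_) (vecs xs n)) _ F)
                      (cong₂ _+_ (∑-map (y ∷_) (vecs xs n) F) (go ys))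

length-vecs : ∀ (xs : List A) n → length (vecs xs n) ≡ length xs ^ n
length-vecs xs n = trans (sym (trans (∑-const (vecs xs n) 1) (*-identityʳ _))) (go n)
  where
  open ≡-Reasoning
  go : ∀ n → ∑ (vecs xs n) (λ _ → 1) ≡ length xs ^ n
  go zero    = refl
  go (suc n) = begin
    ∑ (vecs xs (suc n)) (λ _ → 1)              ≡⟨ ∑-vecs-suc xs n _ ⟩
    ∑ xs (λ _ → ∑ (vecs xs n) (λ _ → 1))       ≡⟨ ∑-const xs _ ⟩
    length xs * ∑ (vecs xs n) (λ _ → 1)        ≡⟨ cong (length xs *_) (go n) ⟩
    length xs * length xs ^ n                  ∎

module _ {P : A → Set} (P? : Decidable P) (xs : List A) where
  open ≡-Reasoning

  -- Turns a sum over tuples from a varying sublist into a sum over a fixed range, so that the order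
  -- of summation can be exchanged.
  ∑-vecs-filter : ∀ n (F : Vec A n → ℕ) →
    ∑ (vecs (filter P? xs) n) F ≡ ∑ (vecs xs n) (λ v → 𝟙 (All.all? P? (toList v)) * F v)
  ∑-vecs-filter zero    F = cong (_+ 0) (sym (*-identityˡ (F [])))
  ∑-vecs-filter (suc n) F = begin
    ∑ (vecs (filter P? xs) (suc n)) F
      ≡⟨ ∑-vecs-suc (filter P? xs) n F ⟩
    ∑ (filter P? xs) (λ x → ∑ (vecs (filter P? xs) n) (λ v → F (x ∷ v)))
      ≡⟨ ∑-filter P? xs _ ⟩
    ∑ xs (λ x → 𝟙 (P? x) * ∑ (vecs (filter P? xs) n) (λ v → F (x ∷ v)))
      ≡⟨ ∑-cong xs (λ x → cong (𝟙 (P? x) *_) (∑-vecs-filter n (F ∘ (x ∷_)))) ⟩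
    ∑ xs (λ x → 𝟙 (P? x) * ∑ (vecs xs n) (λ v → 𝟙 (All.all? P? (toList v)) * F (x ∷ v)))
      ≡⟨ ∑-cong xs (λ x → sym (∑-*ˡ (vecs xs n) (𝟙 (P? x)) _)) ⟩
    ∑ xs (λ x → ∑ (vecs xs n) (λ v → 𝟙 (P? x) * (𝟙 (All.all? P? (toList v)) * F (x ∷ v))))
      ≡⟨ ∑-cong xs (λ x → ∑-cong (vecs xs n) λ v → step x v) ⟩
    ∑ xs (λ x → ∑ (vecs xs n) (λ v → 𝟙 (All.all? P? (x ∷ toList v)) * F (x ∷ v)))
      ≡⟨ ∑-vecs-suc xs n _ ⟨
    ∑ (vecs xs (suc n)) (λ v → 𝟙 (All.all? P? (toList v)) * F v) ∎
    where
    step : ∀ x (v : Vec A n) → 𝟙 (P? x) * (𝟙 (All.all? P? (toList v)) * F (x ∷ v)) ≡ 𝟙 (All.all? P? (x ∷ toList v)) * F (x ∷ v)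
    step x v = trans (sym (*-assoc (𝟙 (P? x)) _ _)) (cong (_* F (x ∷ v)) (sym
      (𝟙-× (All.all? P? (x ∷ toList v)) (P? x) (All.all? P? (toList v)) All.uncons λ (p , ps) → p ∷ ps)))

  ∑-vecs-all : ∀ n → ∑ (vecs xs n) (λ v → 𝟙 (All.all? P? (toList v))) ≡ ∑ xs (λ x → 𝟙 (P? x)) ^ n
  ∑-vecs-all n = begin
    ∑ (vecs xs n) (λ v → 𝟙 (All.all? P? (toList v)))      ≡⟨ ∑-cong (vecs xs n) (λ v → sym (*-identityʳ _)) ⟩
    ∑ (vecs xs n) (λ v → 𝟙 (All.all? P? (toList v)) * 1)  ≡⟨ ∑-vecs-filter n (λ _ → 1) ⟨
    ∑ (vecs (filter P? xs) n) (λ _ → 1)                   ≡⟨ ∑-const (vecs (filter P? xs) n) 1 ⟩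
    length (vecs (filter P? xs) n) * 1                    ≡⟨ *-identityʳ _ ⟩
    length (vecs (filter P? xs) n)                        ≡⟨ length-vecs (filter P? xs) n ⟩
    length (filter P? xs) ^ n                             ≡⟨ cong (_^ n) (length-filter P? xs) ⟩
    ∑ xs (λ x → 𝟙 (P? x)) ^ n                             ∎
-- Each vector arises from `length xs` pairs `(f , x)`, one for every possible overwritten entry. In
-- other words, re-drawing one coordinate preserves the uniform distribution.
∑-resample : ∀ (xs : List A) (i : Fin n) (F : Vec A n → ℕ) →
  ∑ (vecs xs n) (λ f → ∑ xs (λ x → F (f [ i ]≔ x))) ≡ length xs * ∑ (vecs xs n) F
∑-resample {n = suc n} xs zero F = begin
  ∑ (vecs xs (suc n)) (λ f → ∑ xs (λ x → F (f [ zero ]≔ x)))     ≡⟨ ∑-vecs-suc xs n _ ⟩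
  ∑ xs (λ _ → ∑ (vecs xs n) (λ f → ∑ xs (λ x → F (x ∷ f))))      ≡⟨ ∑-const xs _ ⟩
  length xs * ∑ (vecs xs n) (λ f → ∑ xs (λ x → F (x ∷ f)))       ≡⟨ cong (length xs *_) (∑-swap (vecs xs n) xs _) ⟩
  length xs * ∑ xs (λ x → ∑ (vecs xs n) (λ f → F (x ∷ f)))       ≡⟨ cong (length xs *_) (∑-vecs-suc xs n F) ⟨
  length xs * ∑ (vecs xs (suc n)) F                              ∎
  where open ≡-Reasoning
∑-resample {n = suc n} xs (suc i) F = begin
  ∑ (vecs xs (suc n)) (λ f → ∑ xs (λ x → F (f [ suc i ]≔ x)))              ≡⟨ ∑-vecs-suc xs n _ ⟩
  ∑ xs (λ y → ∑ (vecs xs n) (λ f → ∑ xs (λ x → F (y ∷ (f [ i ]≔ x)))))     ≡⟨ ∑-cong xs (λ y → ∑-resample xs i (F ∘ (y ∷_))) ⟩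
  ∑ xs (λ y → length xs * ∑ (vecs xs n) (λ f → F (y ∷ f)))                 ≡⟨ ∑-*ˡ xs (length xs) _ ⟩
  length xs * ∑ xs (λ y → ∑ (vecs xs n) (λ f → F (y ∷ f)))                 ≡⟨ cong (length xs *_) (∑-vecs-suc xs n F) ⟨
  length xs * ∑ (vecs xs (suc n)) F                                        ∎
  where open ≡-Reasoning

-- Independence of functions of disjoint sets of coordinates.

Agree : Subset n → Vec A n → Vec A n → Set
Agree p f g = ∀ {i} → i ∈ p → lookup f i ≡ lookup g i

Agree-∷ : ∀ s (p : Subset n) x {f g : Vec A n} → Agree p f g → Agree (s ∷ p) (x ∷ f) (x ∷ g)
Agree-∷ s p x a {zero}  i∈ = refl
Agree-∷ s p x a {suc i} i∈ = a (drop-there i∈)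

Agree-outside : ∀ {p : Subset n} x y {f : Vec A n} → Agree (outside ∷ p) (x ∷ f) (y ∷ f)
Agree-outside x y {i = suc i} i∈ = refl

DependsOn : Subset n → (Vec A n → ℕ) → Set
DependsOn p F = ∀ {f g} → Agree p f g → F f ≡ F g

-- The expectation of a product of independent functions, with denominators cleared: `length xs ^ n`
-- is the number of vectors. The induction splits off the head coordinate and factors the sum over
-- it.
∑-independent : ∀ (xs : List A) (p q : Subset n) {F G : Vec A n → ℕ} → (∀ {i} → i ∈ p → i ∉ q) →
  DependsOn p F → DependsOn q G →
  ∑ (vecs xs n) (λ f → F f * G f) * length xs ^ n ≡ ∑ (vecs xs n) F * ∑ (vecs xs n) G
∑-independent xs [] [] {F} {G} disj dF dG = lemma (F []) (G [])
  where
  lemma : ∀ a b → (a * b + 0) * 1 ≡ (a + 0) * (b + 0)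
  lemma = solve-∀
∑-independent {A = A} {n = suc n} xs (s ∷ p) (t ∷ q) {F} {G} disj dF dG = begin
  ∑ (vecs xs (suc n)) (λ f → F f * G f) * (m * m ^ n)
    ≡⟨ cong (_* (m * m ^ n)) (∑-vecs-suc xs n _) ⟩
  ∑ xs (λ x → ∑ (vecs xs n) (λ f → F (x ∷ f) * G (x ∷ f))) * (m * m ^ n)
    ≡⟨ lemma (∑ xs λ x → ∑ (vecs xs n) λ f → F (x ∷ f) * G (x ∷ f)) m (m ^ n) ⟩
  ∑ xs (λ x → ∑ (vecs xs n) (λ f → F (x ∷ f) * G (x ∷ f))) * m ^ n * m
    ≡⟨ cong (_* m) (sym (∑-*ʳ xs _ (m ^ n))) ⟩
  ∑ xs (λ x → ∑ (vecs xs n) (λ f → F (x ∷ f) * G (x ∷ f)) * m ^ n) * m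
    ≡⟨ cong (_* m) (∑-cong xs λ x → ∑-independent xs p q (λ i∈p i∈q → disj (Vec.there i∈p) (Vec.there i∈q))
         (λ a → dF (Agree-∷ s p x a)) (λ a → dG (Agree-∷ t q x a))) ⟩
  ∑ xs (λ x → F′ x * G′ x) * m
    ≡⟨ factor s t dF dG disj ⟩
  ∑ xs F′ * ∑ xs G′
    ≡⟨ cong₂ _*_ (∑-vecs-suc xs n F) (∑-vecs-suc xs n G) ⟨
  ∑ (vecs xs (suc n)) F * ∑ (vecs xs (suc n)) G ∎
  where
  open ≡-Reasoning
  m = length xs
  F′ G′ : A → ℕ
  F′ x = ∑ (vecs xs n) (λ f → F (x ∷ f))
  G′ x = ∑ (vecs xs n) (λ f → G (x ∷ f))
  lemma : ∀ a b c → a * (b * c) ≡ a * c * b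
  lemma = solve-∀
  -- By disjointness the head coordinate lies in at most one of the two sets, so at least one of the
  -- slices `F′` and `G′` is constant.
  factor : ∀ s t → DependsOn (s ∷ p) F → DependsOn (t ∷ q) G →
    (∀ {i} → i ∈ (s ∷ p) → i ∉ (t ∷ q)) → ∑ xs (λ x → F′ x * G′ x) * m ≡ ∑ xs F′ * ∑ xs G′
  factor outside _       dF dG _    = ∑-*-constˡ xs F′ G′ λ x y → ∑-cong (vecs xs n) λ f → dF (Agree-outside x y)
  factor inside  outside dF dG _    = ∑-*-constʳ xs F′ G′ λ x y → ∑-cong (vecs xs n) λ f → dG (Agree-outside x y)
  factor inside  inside  dF dG disj = contradiction Vec.here (disj Vec.here)

-- Restriction of a vector to a set of coordinates.

-- A plain list is produced so that neighbourhoods of different sizes fall under one and the same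
-- property of lists.
select : Subset n → Vec A n → List A
select []            []      = []
select (inside  ∷ p) (x ∷ f) = x ∷ select p f
select (outside ∷ p) (x ∷ f) = select p f

length-select : ∀ (p : Subset n) (f : Vec A n) → length (select p f) ≡ ∣ p ∣
length-select []            []      = refl
length-select (inside  ∷ p) (x ∷ f) = cong suc (length-select p f)
length-select (outside ∷ p) (x ∷ f) = length-select p f

select-cong : ∀ (p : Subset n) {f g : Vec A n} → Agree p f g → select p f ≡ select p g
select-cong []            {[]}    {[]}    a = refl
select-cong (inside  ∷ p) {x ∷ f} {y ∷ g} a = cong₂ _∷_ (a Vec.here) (select-cong p (a ∘ Vec.there))
select-cong (outside ∷ p) {x ∷ f} {y ∷ g} a = select-cong p (a ∘ Vec.there)

lookup∈select : ∀ {p : Subset n} (f : Vec A n) {i} → i ∈ p → lookup f i List.∈ select p f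
lookup∈select                   (x ∷ f) Vec.here        = Any.here refl
lookup∈select {p = inside  ∷ p} (x ∷ f) (Vec.there i∈p) = Any.there (lookup∈select f i∈p)
lookup∈select {p = outside ∷ p} (x ∷ f) (Vec.there i∈p) = lookup∈select f i∈p

-- A uniform vector restricted to `p` is a uniform tuple of length at most `d`, and padding it with
-- further uniform entries cannot decrease `F`. Denominators are cleared on both sides.
∑-select : ∀ (xs : List A) (F : List A → ℕ) → (∀ as bs → F as ≤ F (as ++ bs)) →
  ∀ (p : Subset n) d → ∣ p ∣ ≤ d →
  ∑ (vecs xs n) (F ∘ select p) * length xs ^ d ≤ length xs ^ n * ∑ (vecs xs d) (F ∘ toList)
∑-select xs F mono [] d _ = begin
  (F [] + 0) * length xs ^ d               ≡⟨ trans (cong (_* length xs ^ d) (+-identityʳ (F []))) (*-comm (F []) _) ⟩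
  length xs ^ d * F []                     ≡⟨ cong (_* F []) (length-vecs xs d) ⟨
  length (vecs xs d) * F []                ≡⟨ ∑-const (vecs xs d) (F []) ⟨
  ∑ (vecs xs d) (λ _ → F [])               ≤⟨ ∑-mono (vecs xs d) (λ v → mono [] (toList v)) ⟩
  ∑ (vecs xs d) (F ∘ toList)               ≡⟨ *-identityˡ _ ⟨
  1 * ∑ (vecs xs d) (F ∘ toList)           ∎
  where open ≤-Reasoning
∑-select {n = suc n} xs F mono (outside ∷ p) d le = begin
  ∑ (vecs xs (suc n)) (F ∘ select (outside ∷ p)) * m ^ d    ≡⟨ cong (_* m ^ d) (trans (∑-vecs-suc xs n _) (∑-const xs _)) ⟩
  m * ∑ (vecs xs n) (F ∘ select p) * m ^ d                  ≡⟨ *-assoc m _ _ ⟩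
  m * (∑ (vecs xs n) (F ∘ select p) * m ^ d)                ≤⟨ *-monoʳ-≤ m (∑-select xs F mono p d le) ⟩
  m * (m ^ n * ∑ (vecs xs d) (F ∘ toList))                  ≡⟨ *-assoc m _ _ ⟨
  m * m ^ n * ∑ (vecs xs d) (F ∘ toList)                    ∎
  where
  open ≤-Reasoning
  m = length xs
∑-select {n = suc n} xs F mono (inside ∷ p) (suc d) (s≤s le) = begin
  ∑ (vecs xs (suc n)) (F ∘ select (inside ∷ p)) * (m * m ^ d)
    ≡⟨ cong (_* (m * m ^ d)) (∑-vecs-suc xs n _) ⟩
  ∑ xs (λ x → ∑ (vecs xs n) (F ∘ (x ∷_) ∘ select p)) * (m * m ^ d)
    ≡⟨ lemma (∑ xs λ x → ∑ (vecs xs n) (F ∘ (x ∷_) ∘ select p)) m (m ^ d) ⟩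
  m * (∑ xs (λ x → ∑ (vecs xs n) (F ∘ (x ∷_) ∘ select p)) * m ^ d)
    ≡⟨ cong (m *_) (∑-*ʳ xs _ (m ^ d)) ⟨
  m * ∑ xs (λ x → ∑ (vecs xs n) (F ∘ (x ∷_) ∘ select p) * m ^ d)
    ≤⟨ *-monoʳ-≤ m (∑-mono xs λ x → ∑-select xs (F ∘ (x ∷_)) (λ as bs → mono (x ∷ as) bs) p d le) ⟩
  m * ∑ xs (λ x → m ^ n * ∑ (vecs xs d) (F ∘ (x ∷_) ∘ toList))
    ≡⟨ cong (m *_) (∑-*ˡ xs (m ^ n) _) ⟩
  m * (m ^ n * ∑ xs (λ x → ∑ (vecs xs d) (F ∘ (x ∷_) ∘ toList)))
    ≡⟨ *-assoc m _ _ ⟨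
  m * m ^ n * ∑ xs (λ x → ∑ (vecs xs d) (F ∘ (x ∷_) ∘ toList))
    ≡⟨ cong (m * m ^ n *_) (∑-vecs-suc xs d _) ⟨
  m * m ^ n * ∑ (vecs xs (suc d)) (F ∘ toList) ∎
  where
  open ≤-Reasoning
  m = length xs
  lemma : ∀ a b c → a * (b * c) ≡ b * (a * c)
  lemma = solve-∀

-- Removing vertices one at a time.

-- Removal goes vertex by vertex because the counting argument charges a factor 2 to each single
-- deletion.
peel : List (Fin n) → Subset n → Subset n
peel us q = foldr (λ u r → r - u) q us

peel-⊆ : ∀ us (q : Subset n) → peel us q ⊆ q
peel-⊆ []       q = λ i∈ → i∈
peel-⊆ (u ∷ us) q = peel-⊆ us q ∘ p─q⊆p _ _

i∉p-i : ∀ (p : Subset n) i → i ∉ p - i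
i∉p-i (inside  ∷ p) zero    ()
i∉p-i (outside ∷ p) zero    ()
i∉p-i (s ∷ p)       (suc i) (Vec.there h) = i∉p-i p i h

peel-∉ : ∀ us (q : Subset n) {i} → i List.∈ us → i ∉ peel us q
peel-∉ (u ∷ us) q (Any.here refl) = i∉p-i _ u
peel-∉ (u ∷ us) q (Any.there i∈)  = peel-∉ us q i∈ ∘ p─q⊆p _ _

-- Rosenfeld's counting argument.

-- f ranges over L^n, the e w are hyperedges, and B is the property that f restricted to one should avoid.
module Counting
  {N} (L : List (Fin N)) {n} (e : Fin n → Subset n) (D : ℕ)
  {B : List (Fin N) → Set} (B? : Decidable B)
  where

  m bad : ℕ
  m   = length L
  bad = ∑ (vecs L D) (λ t → 𝟙 (B? (toList t)))

  V : List (Vec (Fin N) n)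
  V = vecs L n

  Bad? : ∀ w (f : Vec (Fin N) n) → Dec (B (select (e w) f))
  Bad? w f = B? (select (e w) f)

  -- Hyperedges that leave `q` impose no condition, so goodness on `q` depends only on the entries
  -- indexed by `q`.
  Good : Subset n → Vec (Fin N) n → Set
  Good q f = (∀ u v → u ∈ q → v ∈ q → u ≢ v → lookup f u ≢ lookup f v)
           × (∀ w → e w ⊆ q → ¬ B (select (e w) f))

  Good? : ∀ q f → Dec (Good q f)
  Good? q f =
    (Fin.all? λ u → Fin.all? λ v →
      (u ∈? q) →-dec (v ∈? q) →-dec ¬? (u Fin.≟ v) →-dec ¬? (lookup f u Fin.≟ lookup f v))
    ×-dec (Fin.all? λ w → (e w ⊆? q) →-dec ¬? (Bad? w f))

  count : Subset n → ℕ
  count q = ∑ V (λ f → 𝟙 (Good? q f))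

  Good-antitone : ∀ {p q f} → p ⊆ q → Good q f → Good p f
  Good-antitone p⊆q (inj , ok) =
    (λ u v u∈ v∈ → inj u v (p⊆q u∈) (p⊆q v∈)) , (λ w e⊆ → ok w (p⊆q ∘ e⊆))

  count-antitone : ∀ {p q} → p ⊆ q → count q ≤ count p
  count-antitone p⊆q = ∑-mono V λ f → 𝟙-mono (Good? _ f) (Good? _ f) (Good-antitone p⊆q)

  Good-agree : ∀ {q f g} → Agree q f g → Good q f → Good q g
  Good-agree {q} {f} {g} a (inj , ok) =
    (λ u v u∈ v∈ u≢v eq → inj u v u∈ v∈ u≢v (trans (a u∈) (trans eq (sym (a v∈))))) ,
    (λ w e⊆ b → ok w e⊆ (subst B (sym (select-cong (e w) (λ i∈ → a (e⊆ i∈)))) b))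

  Good-dependsOn : ∀ q → DependsOn q (λ f → 𝟙 (Good? q f))
  Good-dependsOn q {f} {g} a = 𝟙-cong (Good? q f) (Good? q g) (Good-agree {q} a) (Good-agree {q} λ i∈ → sym (a i∈))

  Bad-dependsOn : ∀ w → DependsOn (e w) (λ f → 𝟙 (Bad? w f))
  Bad-dependsOn w a = cong (𝟙 ∘ B?) (select-cong (e w) a)

  -- The factor 2 is assumed for every subset of `q` because the peeling passes through such sets;
  -- this is the form in which the induction of `count-halves` supplies it.
  count-peel : ∀ us q → (∀ {r} → r ⊆ q → ∀ u → count (r - u) ≤ 2 * count r) →
    count (peel us q) ≤ 2 ^ length us * count q
  count-peel []       q h = ≤-reflexive (sym (*-identityˡ (count q)))
  count-peel (u ∷ us) q h = begin
    count (peel us q - u)             ≤⟨ h (peel-⊆ us q) u ⟩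
    2 * count (peel us q)             ≤⟨ *-monoʳ-≤ 2 (count-peel us q h) ⟩
    2 * (2 ^ length us * count q)     ≡⟨ *-assoc 2 (2 ^ length us) (count q) ⟨
    2 ^ length (u ∷ us) * count q     ∎
    where open ≤-Reasoning

  Collision? : ∀ (u v : Fin n) (f : Vec (Fin N) n) → Dec (u ≢ v × lookup f v ≡ lookup f u)
  Collision? u v f = ¬? (u Fin.≟ v) ×-dec (lookup f v Fin.≟ lookup f u)

  collisions spoiled : Subset n → Fin n → Fin n → ℕ
  collisions q v u = ∑ V λ f → 𝟙 (Collision? u v f) * 𝟙 (Good? (q - v) f)
  spoiled    q v w = ∑ V λ f → 𝟙 (Good? (q - v) f) * 𝟙 (Bad? w f)

  -- A pointwise union bound: a map that is good on `q - v` can fail on `q` only through a collision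
  -- with `v` or a bad hyperedge containing `v`.
  Good-extend : ∀ q v f → 𝟙 (Good? (q - v) f) ≤ 𝟙 (Good? q f) +
    ((∑[ u ∈ allFin n ] 𝟙 (Collision? u v f) * 𝟙 (Good? (q - v) f)) +
     (∑[ w ∈ allFin n ] 𝟙 (v ∈? e w) * (𝟙 (Good? (q - v) f) * 𝟙 (Bad? w f))))
  Good-extend q v f with Good? (q - v) f
  ... | no _ = z≤n
  ... | yes (inj , ok) with Fin.any? (λ u → Collision? u v f)
  ...   | yes (u , coll) = ≤-trans
            (≤-trans (≤-reflexive (sym (trans (*-identityʳ _) (𝟙-yes (Collision? u v f) coll))))
                     (∑-member (λ u → 𝟙 (Collision? u v f) * 1) (∈-allFin u)))
            (≤-trans (m≤m+n _ _) (m≤n+m _ (𝟙 (Good? q f))))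
  ...   | no ¬coll with Fin.any? (λ w → (v ∈? e w) ×-dec Bad? w f)
  ...     | yes (w , v∈ , b) = ≤-trans
              (≤-trans (≤-reflexive (sym (cong₂ _*_ (𝟙-yes (v ∈? e w) v∈) (cong (1 *_) (𝟙-yes (Bad? w f) b)))))
                       (∑-member (λ w → 𝟙 (v ∈? e w) * (1 * 𝟙 (Bad? w f))) (∈-allFin w)))
              (≤-trans (m≤n+m _ _) (m≤n+m _ (𝟙 (Good? q f))))
  ...     | no ¬bad = ≤-trans (≤-reflexive (sym (𝟙-yes (Good? q f) (inj′ , ok′)))) (m≤m+n _ _)
    where
    inj′ : ∀ a b → a ∈ q → b ∈ q → a ≢ b → lookup f a ≢ lookup f b
    inj′ a b a∈ b∈ a≢b eq with a Fin.≟ v | b Fin.≟ v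
    ... | yes refl | _        = ¬coll (b , (a≢b ∘ sym) , eq)
    ... | no a≢v   | yes refl = ¬coll (a , a≢b , sym eq)
    ... | no a≢v   | no b≢v   = inj a b (x∈p∧x≢y⇒x∈p-y a∈ a≢v) (x∈p∧x≢y⇒x∈p-y b∈ b≢v) a≢b eq
    ok′ : ∀ w → e w ⊆ q → ¬ B (select (e w) f)
    ok′ w e⊆ b with v ∈? e w
    ... | yes v∈ = ¬bad (w , v∈ , b)
    ... | no v∉  = ok w (λ i∈ → x∈p∧x≢y⇒x∈p-y (e⊆ i∈) λ { refl → v∉ i∈ }) b

  count-extend : ∀ q v → count (q - v) ≤ count q +
    ((∑[ u ∈ allFin n ] collisions q v u) + (∑[ w ∈ allFin n ] 𝟙 (v ∈? e w) * spoiled q v w))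
  count-extend q v = begin
    count (q - v)
      ≤⟨ ∑-mono V (Good-extend q v) ⟩
    ∑ V (λ f → 𝟙 (Good? q f) + (c f + s f))
      ≡⟨ trans (∑-+ V _ _) (cong (count q +_) (∑-+ V c s)) ⟩
    count q + (∑ V c + ∑ V s)
      ≡⟨ cong (count q +_) (cong₂ _+_ (∑-swap V (allFin n) _)
           (trans (∑-swap V (allFin n) _) (∑-cong (allFin n) λ w → ∑-*ˡ V (𝟙 (v ∈? e w)) _))) ⟩
    count q + ((∑[ u ∈ allFin n ] collisions q v u) + (∑[ w ∈ allFin n ] 𝟙 (v ∈? e w) * spoiled q v w)) ∎
    where
    open ≤-Reasoning
    c s : Vec (Fin N) n → ℕ
    c f = ∑[ u ∈ allFin n ] 𝟙 (Collision? u v f) * 𝟙 (Good? (q - v) f)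
    s f = ∑[ w ∈ allFin n ] 𝟙 (v ∈? e w) * (𝟙 (Good? (q - v) f) * 𝟙 (Bad? w f))

  module _ (L-unique : ∀ z → ∑ L (λ x → 𝟙 (x Fin.≟ z)) ≤ 1) where

    -- Re-draw the image of `v`. Goodness on `q - v` does not notice the change, and at most one
    -- entry of `L` equals the image of `u`.
    collisions-≤ : ∀ q v u → m * collisions q v u ≤ count (q - v)
    collisions-≤ q v u = begin
      m * collisions q v u
        ≡⟨ ∑-resample L v _ ⟨
      ∑ V (λ f → ∑ L λ x → 𝟙 (Collision? u v (f [ v ]≔ x)) * 𝟙 (Good? (q - v) (f [ v ]≔ x)))
        ≤⟨ ∑-mono V (λ f → ∑-mono L λ x → *-mono-≤
             (𝟙-mono (Collision? u v (f [ v ]≔ x)) (x Fin.≟ lookup f u) (hit f x))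
             (≤-reflexive (Good-dependsOn (q - v) (unchanged f x)))) ⟩
      ∑ V (λ f → ∑ L λ x → 𝟙 (x Fin.≟ lookup f u) * 𝟙 (Good? (q - v) f))
        ≡⟨ ∑-cong V (λ f → ∑-*ʳ L _ _) ⟩
      ∑ V (λ f → ∑ L (λ x → 𝟙 (x Fin.≟ lookup f u)) * 𝟙 (Good? (q - v) f))
        ≤⟨ ∑-mono V (λ f → *-monoˡ-≤ (𝟙 (Good? (q - v) f)) (L-unique (lookup f u))) ⟩
      ∑ V (λ f → 1 * 𝟙 (Good? (q - v) f))
        ≡⟨ ∑-cong V (λ f → *-identityˡ _) ⟩
      count (q - v) ∎
      where
      open ≤-Reasoning
      hit : ∀ f x → u ≢ v × lookup (f [ v ]≔ x) v ≡ lookup (f [ v ]≔ x) u → x ≡ lookup f u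
      hit f x (u≢v , eq) = trans (sym (Vec.lookup∘update v f x)) (trans eq (Vec.lookup∘update′ u≢v f x))
      unchanged : ∀ f x → Agree (q - v) (f [ v ]≔ x) f
      unchanged f x i∈ = Vec.lookup∘update′ (λ { refl → i∉p-i q v i∈ }) f x

  module _ .{{_ : NonZero m}}
    (B-++ : ∀ xs ys → B xs → B (xs ++ ys))
    (small : ∀ w → ∣ e w ∣ ≤ D) where

    -- Dropping the vertices of e w makes "good" and "bad at w" independent events,
    -- at the cost of a factor 2 per vertex dropped.
    spoiled-≤ : ∀ q v w → (∀ {r} → r ⊆ q - v → ∀ u → count (r - u) ≤ 2 * count r) →
      spoiled q v w * m ^ D ≤ 2 ^ D * (count (q - v) * bad)
    spoiled-≤ q v w h = *-cancelˡ-≤ (m ^ n) {{m^n≢0 m n}} (begin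
      m ^ n * (spoiled q v w * m ^ D)
        ≡⟨ lemma₁ (m ^ n) (spoiled q v w) (m ^ D) ⟩
      spoiled q v w * m ^ n * m ^ D
        ≤⟨ *-monoˡ-≤ (m ^ D) (*-monoˡ-≤ (m ^ n) (∑-mono V λ f → *-monoˡ-≤ (𝟙 (Bad? w f))
             (𝟙-mono (Good? (q - v) f) (Good? r f) (Good-antitone (peel-⊆ us (q - v)))))) ⟩
      ∑ V (λ f → 𝟙 (Good? r f) * 𝟙 (Bad? w f)) * m ^ n * m ^ D
        ≡⟨ cong (_* m ^ D) (∑-independent L r (e w) disjoint (Good-dependsOn r) (Bad-dependsOn w)) ⟩
      count r * ∑ V (λ f → 𝟙 (Bad? w f)) * m ^ D
        ≡⟨ *-assoc (count r) _ (m ^ D) ⟩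
      count r * (∑ V (λ f → 𝟙 (Bad? w f)) * m ^ D)
        ≤⟨ *-mono-≤ (count-peel us (q - v) h)
             (∑-select L (𝟙 ∘ B?) (λ xs ys → 𝟙-mono (B? xs) (B? (xs ++ ys)) (B-++ xs ys)) (e w) D (small w)) ⟩
      2 ^ length us * count (q - v) * (m ^ n * bad)
        ≤⟨ *-monoˡ-≤ (m ^ n * bad) (*-monoˡ-≤ (count (q - v)) (^-monoʳ-≤ 2
             (≤-trans (≤-reflexive (length-select (e w) _)) (small w)))) ⟩
      2 ^ D * count (q - v) * (m ^ n * bad)
        ≡⟨ lemma₂ (2 ^ D) (count (q - v)) (m ^ n) bad ⟩
      m ^ n * (2 ^ D * (count (q - v) * bad)) ∎)
      where
      open ≤-Reasoning
      -- Restricting the identity vector to `e w` lists the vertices of `e w`.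
      us = select (e w) (Vec.allFin n)
      r  = peel us (q - v)
      disjoint : ∀ {i} → i ∈ r → i ∉ e w
      disjoint {i} i∈r i∈e = peel-∉ us (q - v)
        (subst (List._∈ us) (Vec.lookup-allFin i) (lookup∈select (Vec.allFin n) i∈e)) i∈r
      lemma₁ : ∀ a b c → a * (b * c) ≡ b * a * c
      lemma₁ = solve-∀
      lemma₂ : ∀ a b c d → a * b * (c * d) ≡ c * (a * (b * d))
      lemma₂ = solve-∀

    module _ (L-unique : ∀ z → ∑ L (λ x → 𝟙 (x Fin.≟ z)) ≤ 1)
      (degree-≤ : ∀ v → ∑ (allFin n) (λ w → 𝟙 (v ∈? e w)) ≤ D)
      (4n≤m : 4 * n ≤ m)
      (rare : 4 * (D * (2 ^ D * bad)) ≤ m ^ D) where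

      ∑-collisions-≤ : ∀ q v → 4 * (∑[ u ∈ allFin n ] collisions q v u) ≤ count (q - v)
      ∑-collisions-≤ q v = *-cancelˡ-≤ m (begin
        m * (4 * ∑ (allFin n) (collisions q v))          ≡⟨ lemma m 4 _ ⟩
        4 * (m * ∑ (allFin n) (collisions q v))          ≡⟨ cong (4 *_) (∑-*ˡ (allFin n) m _) ⟨
        4 * ∑ (allFin n) (λ u → m * collisions q v u)    ≤⟨ *-monoʳ-≤ 4 (∑-mono (allFin n) (collisions-≤ L-unique q v)) ⟩
        4 * ∑ (allFin n) (λ u → count (q - v))           ≡⟨ cong (4 *_) (trans (∑-const (allFin n) _)
                                                               (cong (_* count (q - v)) (length-tabulate {n = n} (λ i → i)))) ⟩
        4 * (n * count (q - v))                          ≡⟨ *-assoc 4 n _ ⟨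
        4 * n * count (q - v)                            ≤⟨ *-monoˡ-≤ (count (q - v)) 4n≤m ⟩
        m * count (q - v)                                ∎)
        where
        open ≤-Reasoning
        lemma : ∀ a b c → a * (b * c) ≡ b * (a * c)
        lemma = solve-∀

      -- At most `D` hyperedges contain `v`, and each spoils at most a `2 ^ D * bad / m ^ D` share
      -- of the maps; `rare` says that `D` such shares make at most a quarter.
      ∑-spoiled-≤ : ∀ q v → (∀ {r} → r ⊆ q - v → ∀ u → count (r - u) ≤ 2 * count r) →
        4 * (∑[ w ∈ allFin n ] 𝟙 (v ∈? e w) * spoiled q v w) ≤ count (q - v)
      ∑-spoiled-≤ q v h = *-cancelʳ-≤ _ _ (m ^ D) {{m^n≢0 m D}} (begin
        4 * ∑ (allFin n) (λ w → 𝟙 (v ∈? e w) * spoiled q v w) * m ^ D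
          ≡⟨ trans (*-assoc 4 (∑ (allFin n) s) (m ^ D)) (cong (4 *_) (sym (∑-*ʳ (allFin n) s (m ^ D)))) ⟩
        4 * ∑ (allFin n) (λ w → 𝟙 (v ∈? e w) * spoiled q v w * m ^ D)
          ≤⟨ *-monoʳ-≤ 4 (∑-mono (allFin n) λ w → ≤-trans (≤-reflexive (*-assoc (𝟙 (v ∈? e w)) _ _))
               (*-monoʳ-≤ (𝟙 (v ∈? e w)) (spoiled-≤ q v w h))) ⟩
        4 * ∑ (allFin n) (λ w → 𝟙 (v ∈? e w) * (2 ^ D * (count (q - v) * bad)))
          ≡⟨ cong (4 *_) (∑-*ʳ (allFin n) _ _) ⟩
        4 * (∑ (allFin n) (λ w → 𝟙 (v ∈? e w)) * (2 ^ D * (count (q - v) * bad)))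
          ≤⟨ *-monoʳ-≤ 4 (*-monoˡ-≤ _ (degree-≤ v)) ⟩
        4 * (D * (2 ^ D * (count (q - v) * bad)))
          ≡⟨ lemma 4 D (2 ^ D) (count (q - v)) bad ⟩
        count (q - v) * (4 * (D * (2 ^ D * bad)))
          ≤⟨ *-monoʳ-≤ (count (q - v)) rare ⟩
        count (q - v) * m ^ D ∎)
        where
        open ≤-Reasoning
        s : Fin n → ℕ
        s w = 𝟙 (v ∈? e w) * spoiled q v w
        lemma : ∀ a b c d e → a * (b * (c * (d * e))) ≡ d * (a * (b * (c * e)))
        lemma = solve-∀

      -- Well-founded induction on `q`. The bound on spoiled maps peels further vertices off
      -- `q - v`, so it calls on the claim for subsets of `q - v`; these are proper subsets of `q`
      -- once `v` lies in `q`.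
      count-halves : ∀ {q} → Acc _⊂_ q → ∀ v → count (q - v) ≤ 2 * count q
      count-halves {q} (acc rec) v with v ∈? q
      ... | no v∉ = ≤-trans (count-antitone λ i∈ → x∈p∧x≢y⇒x∈p-y i∈ λ { refl → v∉ i∈ }) (m≤m+n _ _)
      -- Collisions and bad hyperedges each cost at most a quarter of `count (q - v)`. After
      -- multiplication by four, half of the left side cancels against them.
      ... | yes v∈ = *-cancelˡ-≤ 2 (+-cancelˡ-≤ (2 * count (q - v)) _ _ (begin
        2 * count (q - v) + 2 * count (q - v)
          ≡⟨ lemma₁ (count (q - v)) ⟩
        4 * count (q - v)
          ≤⟨ *-monoʳ-≤ 4 (count-extend q v) ⟩
        4 * (count q + (∑ (allFin n) (collisions q v) + ∑ (allFin n) (λ w → 𝟙 (v ∈? e w) * spoiled q v w)))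
          ≡⟨ lemma₂ (count q) (∑ (allFin n) (collisions q v)) _ ⟩
        4 * ∑ (allFin n) (collisions q v) + 4 * ∑ (allFin n) (λ w → 𝟙 (v ∈? e w) * spoiled q v w) + 2 * (2 * count q)
          ≤⟨ +-monoˡ-≤ (2 * (2 * count q)) (+-mono-≤ (∑-collisions-≤ q v)
               (∑-spoiled-≤ q v λ r⊆ → count-halves (rec (⊆-⊂-trans r⊆ (x∈p⇒p-x⊂p v∈))))) ⟩
        count (q - v) + count (q - v) + 2 * (2 * count q)
          ≡⟨ cong (_+ 2 * (2 * count q)) (lemma₃ (count (q - v))) ⟩
        2 * count (q - v) + 2 * (2 * count q) ∎))
        where
        open ≤-Reasoning
        lemma₁ : ∀ a → 2 * a + 2 * a ≡ 4 * a
        lemma₁ = solve-∀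
        lemma₂ : ∀ a b c → 4 * (a + (b + c)) ≡ 4 * b + 4 * c + 2 * (2 * a)
        lemma₂ = solve-∀
        lemma₃ : ∀ a → a + a ≡ 2 * a
        lemma₃ = solve-∀

      -- Once every vertex is peeled off, all `m ^ n` maps are good: only empty hyperedges are left
      -- to check, and these are covered by `¬ B []`. Putting the vertices back divides the count by
      -- at most a power of 2, so it stays positive.
      ∃-good : ¬ B [] → ∃ λ f → Good ⊤ f
      ∃-good ¬B[] = case ∑-<⇒∃ V {λ _ → 0} {λ f → 𝟙 (Good? ⊤ f)} 0<count of λ (f , lt) → f , 𝟙>0⇒ (Good? ⊤ f) lt
        where
        open ≤-Reasoning
        r = peel (allFin n) ⊤
        empty : ∀ {i} → i ∉ r
        empty {i} = peel-∉ (allFin n) ⊤ (∈-allFin i)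
        select-empty : ∀ {k} (p : Subset k) (f : Vec (Fin N) k) → (∀ {i} → i ∉ p) → select p f ≡ []
        select-empty []            []      h = refl
        select-empty (inside  ∷ p) (x ∷ f) h = contradiction Vec.here h
        select-empty (outside ∷ p) (x ∷ f) h = select-empty p f (h ∘ Vec.there)
        all-good : ∀ f → Good r f
        all-good f = (λ u v u∈ → contradiction u∈ empty) ,
                     (λ w e⊆ b → ¬B[] (subst B (select-empty (e w) f (empty ∘ e⊆)) b))
        0<count : ∑ V (λ _ → 0) < count ⊤
        0<count = *-cancelˡ-< (2 ^ length (allFin n)) _ _ (begin-strict
          2 ^ length (allFin n) * ∑ V (λ _ → 0)
            ≡⟨ trans (cong (2 ^ length (allFin n) *_) (trans (∑-const V 0) (*-zeroʳ (length V)))) (*-zeroʳ (2 ^ length (allFin n))) ⟩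
          0
            <⟨ m^n>0 m n ⟩
          m ^ n
            ≡⟨ length-vecs L n ⟨
          length V
            ≡⟨ trans (∑-const V 1) (*-identityʳ (length V)) ⟨
          ∑ V (λ _ → 1)
            ≡⟨ ∑-cong V (λ f → 𝟙-yes (Good? r f) (all-good f)) ⟨
          count r
            ≤⟨ count-peel (allFin n) ⊤ (λ _ → count-halves (⊂-wellFounded _)) ⟩
          2 ^ length (allFin n) * count ⊤ ∎)

-- Numerical inequalities.

^-distribʳ-* : ∀ a b d → (a * b) ^ d ≡ a ^ d * b ^ d
^-distribʳ-* a b zero    = refl
^-distribʳ-* a b (suc d) = trans (cong (a * b *_) (^-distribʳ-* a b d)) (lemma a b (a ^ d) (b ^ d))
  where
  lemma : ∀ a b c d → a * b * (c * d) ≡ a * c * (b * d)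
  lemma = solve-∀

-- The sum `a + b` is at most twice the larger term. It serves to compare `N ^ D` with the powers of
-- the two colour degrees of a vertex.
[a+b]^d≤2^d*[a^d+b^d] : ∀ a b d → (a + b) ^ d ≤ 2 ^ d * (a ^ d + b ^ d)
[a+b]^d≤2^d*[a^d+b^d] a b d with ≤-total a b
... | inj₁ a≤b = begin
  (a + b) ^ d               ≤⟨ ^-monoˡ-≤ d (≤-trans (+-monoˡ-≤ b a≤b) (≤-reflexive (cong (b +_) (sym (+-identityʳ b))))) ⟩
  (2 * b) ^ d               ≡⟨ ^-distribʳ-* 2 b d ⟩
  2 ^ d * b ^ d             ≤⟨ *-monoʳ-≤ (2 ^ d) (m≤n+m (b ^ d) (a ^ d)) ⟩
  2 ^ d * (a ^ d + b ^ d)   ∎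
  where open ≤-Reasoning
... | inj₂ b≤a = begin
  (a + b) ^ d               ≤⟨ ^-monoˡ-≤ d (≤-trans (+-monoʳ-≤ a b≤a) (≤-reflexive (cong (a +_) (sym (+-identityʳ a))))) ⟩
  (2 * a) ^ d               ≡⟨ ^-distribʳ-* 2 a d ⟩
  2 ^ d * a ^ d             ≤⟨ *-monoʳ-≤ (2 ^ d) (m≤m+n (a ^ d) (b ^ d)) ⟩
  2 ^ d * (a ^ d + b ^ d)   ∎
  where open ≤-Reasoning

-- Absorbs the linear factor in `4 * d * 2 ^ d`, leaving `16 ^ d`.
4*d≤8^d : ∀ d → 4 * d ≤ 8 ^ d
4*d≤8^d zero    = z≤n
4*d≤8^d (suc d) = begin
  4 * suc d          ≡⟨ *-suc 4 d ⟩
  4 + 4 * d          ≤⟨ +-mono-≤ (*-monoʳ-≤ 4 (m^n>0 8 d)) (4*d≤8^d d) ⟩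
  4 * 8 ^ d + 8 ^ d  ≤⟨ m≤m+n _ (3 * 8 ^ d) ⟩
  4 * 8 ^ d + 8 ^ d + 3 * 8 ^ d ≡⟨ lemma (8 ^ d) ⟩
  8 * 8 ^ d          ∎
  where
  open ≤-Reasoning
  lemma : ∀ a → 4 * a + a + 3 * a ≡ 8 * a
  lemma = solve-∀

∑-allFin-const : ∀ n k → ∑ (allFin n) (λ _ → k) ≡ n * k
∑-allFin-const n k = trans (∑-const (allFin n) k) (cong (_* k) (length-tabulate {n = n} (λ i → i)))

All-swap : ∀ {R : A → B → Set} {xs ys} → All (λ x → All (R x) ys) xs → All (λ y → All (λ x → R x y) xs) ys
All-swap a = All.tabulate λ y∈ → All.tabulate λ x∈ → All.lookup (All.lookup a x∈) y∈

-- Dependent random choice.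

module DependentRandomChoice {N} (χ : Fin N → Fin N → Bool) (n D : ℕ) where

  X : List (Fin N)
  X = allFin N

  W : List (Vec (Fin N) D)
  W = vecs X D

  Adj? : ∀ c x y → Dec (χ x y ≡ c)
  Adj? c x y = χ x y Bool.≟ c

  common : Bool → List (Fin N) → ℕ
  common c xs = ∑ X λ y → 𝟙 (All.all? (λ x → Adj? c x y) xs)

  Few : Bool → List (Fin N) → Set
  Few c xs = common c xs < n

  Few? : ∀ c → Decidable (Few c)
  Few? c xs = common c xs <? n

  common-++ : ∀ c xs ys → common c (xs ++ ys) ≤ common c xs
  common-++ c xs ys = ∑-mono X λ y → 𝟙-mono (All.all? _ (xs ++ ys)) (All.all? _ xs) (All.++⁻ˡ xs)

  Nbr? : ∀ c (t : Vec (Fin N) D) x → Dec (All (λ y → χ x y ≡ c) (toList t))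
  Nbr? c t x = All.all? (Adj? c x) (toList t)

  nbrs : Bool → Vec (Fin N) D → List (Fin N)
  nbrs c t = filter (Nbr? c t) X

  -- The tuples are drawn from `nbrs c t`, but their common neighbours are counted in the whole of
  -- `K_N`.
  few : Bool → Vec (Fin N) D → ℕ
  few c t = ∑ (vecs (nbrs c t) D) (λ g → 𝟙 (Few? c (toList g)))

  -- The diagonal value `χ x x` is counted too, which makes the two degrees of a vertex add up to
  -- exactly `N`.
  deg : Bool → Fin N → ℕ
  deg c x = ∑ X λ y → 𝟙 (Adj? c x y)

  deg-sum : ∀ x → deg true x + deg false x ≡ N
  deg-sum x = begin
    deg true x + deg false x                                ≡⟨ ∑-+ X _ _ ⟨
    ∑ X (λ y → 𝟙 (Adj? true x y) + 𝟙 (Adj? false x y))      ≡⟨ ∑-cong X (λ y → one (χ x y)) ⟩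
    ∑ X (λ _ → 1)                                           ≡⟨ ∑-allFin-const N 1 ⟩
    N * 1                                                   ≡⟨ *-identityʳ N ⟩
    N                                                       ∎
    where
    open ≡-Reasoning
    one : ∀ b → 𝟙 (b Bool.≟ true) + 𝟙 (b Bool.≟ false) ≡ 1
    one true  = refl
    one false = refl

  -- Double counting of pairs `(t , x)`: for fixed `x`, the entries of `t` are chosen independently
  -- among the `deg c x` neighbours of `x`.
  ∑-nbrs : ∀ c → ∑ W (λ t → length (nbrs c t)) ≡ ∑ X (λ x → deg c x ^ D)
  ∑-nbrs c = begin
    ∑ W (λ t → length (nbrs c t))                ≡⟨ ∑-cong W (λ t → length-filter (Nbr? c t) X) ⟩
    ∑ W (λ t → ∑ X λ x → 𝟙 (Nbr? c t x))         ≡⟨ ∑-swap W X _ ⟩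
    ∑ X (λ x → ∑ W λ t → 𝟙 (Nbr? c t x))         ≡⟨ ∑-cong X (λ x → ∑-vecs-all (Adj? c x) X D) ⟩
    ∑ X (λ x → deg c x ^ D)                      ∎
    where open ≡-Reasoning

  ∑-nbrs-≥ : N * N ^ D ≤ 2 ^ D * (∑ W (λ t → length (nbrs true t)) + ∑ W (λ t → length (nbrs false t)))
  ∑-nbrs-≥ = begin
    N * N ^ D
      ≡⟨ ∑-allFin-const N (N ^ D) ⟨
    ∑ X (λ _ → N ^ D)
      ≤⟨ ∑-mono X (λ x → ≤-trans (≤-reflexive (cong (_^ D) (sym (deg-sum x))))
           ([a+b]^d≤2^d*[a^d+b^d] (deg true x) (deg false x) D)) ⟩
    ∑ X (λ x → 2 ^ D * (deg true x ^ D + deg false x ^ D))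
      ≡⟨ trans (∑-*ˡ X (2 ^ D) _) (cong (2 ^ D *_) (∑-+ X _ _)) ⟩
    2 ^ D * (∑ X (λ x → deg true x ^ D) + ∑ X (λ x → deg false x ^ D))
      ≡⟨ cong (2 ^ D *_) (cong₂ _+_ (∑-nbrs true) (∑-nbrs false)) ⟨
    2 ^ D * (∑ W (λ t → length (nbrs true t)) + ∑ W (λ t → length (nbrs false t))) ∎
    where open ≤-Reasoning

  length-W : length W ≡ N ^ D
  length-W = trans (length-vecs X D) (cong (_^ D) (length-tabulate {n = N} (λ i → i)))

  -- g lies in nbrs c t exactly when t lies in the common neighbourhood of g.
  ∑-few : ∀ c → ∑ W (few c) ≤ N ^ D * n ^ D
  ∑-few c = begin
    ∑ W (few c)
      ≡⟨ ∑-cong W (λ t → ∑-vecs-filter (Nbr? c t) X D _) ⟩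
    ∑ W (λ t → ∑ W λ g → 𝟙 (All.all? (Nbr? c t) (toList g)) * 𝟙 (Few? c (toList g)))
      ≡⟨ ∑-swap W W _ ⟩
    ∑ W (λ g → ∑ W λ t → 𝟙 (All.all? (Nbr? c t) (toList g)) * 𝟙 (Few? c (toList g)))
      ≡⟨ ∑-cong W (λ g → ∑-*ʳ W _ _) ⟩
    ∑ W (λ g → ∑ W (λ t → 𝟙 (All.all? (Nbr? c t) (toList g))) * 𝟙 (Few? c (toList g)))
      ≡⟨ ∑-cong W (λ g → cong (_* 𝟙 (Few? c (toList g))) (trans
           (∑-cong W λ t → 𝟙-cong (All.all? (Nbr? c t) (toList g)) (All.all? (λ y → All.all? (λ x → Adj? c x y) (toList g)) (toList t))
              All-swap All-swap)
           (∑-vecs-all (λ y → All.all? (λ x → Adj? c x y) (toList g)) X D))) ⟩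
    ∑ W (λ g → common c (toList g) ^ D * 𝟙 (Few? c (toList g)))
      ≤⟨ ∑-mono W (λ g → bound (toList g)) ⟩
    ∑ W (λ _ → n ^ D)
      ≡⟨ trans (∑-const W (n ^ D)) (cong (_* n ^ D) length-W) ⟩
    N ^ D * n ^ D ∎
    where
    open ≤-Reasoning
    bound : ∀ g → common c g ^ D * 𝟙 (Few? c g) ≤ n ^ D
    bound g with Few? c g
    ... | yes lt = ≤-trans (≤-reflexive (*-identityʳ _)) (^-monoˡ-≤ D (<⇒≤ lt))
    ... | no _   = ≤-trans (≤-reflexive (*-zeroʳ (common c g ^ D))) z≤n

  -- One inequality carries both demands on `L = nbrs c t`: keeping only the first summand gives
  -- `16 * n ≤ length L`, and keeping only the second bounds the number of tuples with few common
  -- neighbours.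
  ∃-choice : N ≡ 2 ^ (D + 6) * n → 0 < n →
    ∃ λ c → ∃ λ t → 16 * (n * n ^ D + n * few c t) ≤ length (nbrs c t) * n ^ D
  ∃-choice N≡ 0<n =
    let c , lt  = ∑-<⇒∃ colours {λ c → ∑ W (cost c)} {λ c → ∑ W λ t → gain c t + 1} total
        t , lt′ = ∑-<⇒∃ W {cost c} {λ t → gain c t + 1} lt
    in c , t , ≤-pred (≤-trans lt′ (≤-reflexive (+-comm (gain c t) 1)))
    where
    open ≤-Reasoning
    colours : List Bool
    colours = true ∷ false ∷ []
    cost gain : Bool → Vec (Fin N) D → ℕ
    cost c t = 16 * (n * n ^ D + n * few c t)
    gain c t = length (nbrs c t) * n ^ D

    -- By `∑-few` the average of `few c t` over `t` is at most `n ^ D`, so both summands of the cost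
    -- obey the same bound and 16 doubles to 32.
    ∑-cost : ∀ c → ∑ W (cost c) ≤ 32 * (n * (N ^ D * n ^ D))
    ∑-cost c = begin
      ∑ W (cost c)
        ≡⟨ trans (∑-*ˡ W 16 _) (cong (16 *_) (trans (∑-+ W _ _)
             (cong₂ _+_ (trans (∑-const W _) (cong (_* (n * n ^ D)) length-W)) (∑-*ˡ W n (few c))))) ⟩
      16 * (N ^ D * (n * n ^ D) + n * ∑ W (few c))
        ≤⟨ *-monoʳ-≤ 16 (+-monoʳ-≤ (N ^ D * (n * n ^ D)) (*-monoʳ-≤ n (∑-few c))) ⟩
      16 * (N ^ D * (n * n ^ D) + n * (N ^ D * n ^ D))
        ≡⟨ lemma (N ^ D) n (n ^ D) ⟩
      32 * (n * (N ^ D * n ^ D)) ∎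
      where
      lemma : ∀ a b c → 16 * (a * (b * c) + b * (a * c)) ≡ 32 * (b * (a * c))
      lemma = solve-∀

    cost≤gain : ∑ W (cost true) + ∑ W (cost false) ≤ ∑ W (gain true) + ∑ W (gain false)
    cost≤gain = *-cancelˡ-≤ (2 ^ D) {{m^n≢0 2 D}} (begin
      2 ^ D * (∑ W (cost true) + ∑ W (cost false))
        ≤⟨ *-monoʳ-≤ (2 ^ D) (+-mono-≤ (∑-cost true) (∑-cost false)) ⟩
      2 ^ D * (32 * (n * (N ^ D * n ^ D)) + 32 * (n * (N ^ D * n ^ D)))
        ≡⟨ lemma₁ (2 ^ D) n (N ^ D) (n ^ D) ⟩
      2 ^ D * 64 * n * N ^ D * n ^ D
        -- Two colours at 32 each make 64, which is `2 ^ 6`: this fixes the 6 in the exponent of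
        -- `N`.
        ≡⟨ cong (λ a → a * n * N ^ D * n ^ D) (^-distribˡ-+-* 2 D 6) ⟨
      2 ^ (D + 6) * n * N ^ D * n ^ D
        ≡⟨ cong (λ a → a * N ^ D * n ^ D) N≡ ⟨
      N * N ^ D * n ^ D
        ≤⟨ *-monoˡ-≤ (n ^ D) ∑-nbrs-≥ ⟩
      2 ^ D * (∑ W (λ t → length (nbrs true t)) + ∑ W (λ t → length (nbrs false t))) * n ^ D
        ≡⟨ lemma₂ (2 ^ D) (∑ W (λ t → length (nbrs true t))) (∑ W (λ t → length (nbrs false t))) (n ^ D) ⟩
      2 ^ D * (∑ W (λ t → length (nbrs true t)) * n ^ D + ∑ W (λ t → length (nbrs false t)) * n ^ D)
        ≡⟨ cong (2 ^ D *_) (cong₂ _+_ (∑-*ʳ W _ (n ^ D)) (∑-*ʳ W _ (n ^ D))) ⟨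
      2 ^ D * (∑ W (gain true) + ∑ W (gain false)) ∎)
      where
      lemma₁ : ∀ a b c d → a * (32 * (b * (c * d)) + 32 * (b * (c * d))) ≡ a * 64 * b * c * d
      lemma₁ = solve-∀
      lemma₂ : ∀ a b c d → a * (b + c) * d ≡ a * (b * d + c * d)
      lemma₂ = solve-∀

    0<W : 0 < length W
    0<W = ≤-trans (m^n>0 N {{>-nonZero 0<N}} D) (≤-reflexive (sym length-W))
      where
      0<N : 0 < N
      0<N = ≤-trans (*-mono-≤ (m^n>0 2 (D + 6)) 0<n) (≤-reflexive (sym N≡))

    -- Adding 1 to the gain makes the comparison strict, so that it is inherited by some summand.
    total : ∑ colours (λ c → ∑ W (cost c)) < ∑ colours (λ c → ∑ W λ t → gain c t + 1)
    total = begin-strict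
      ∑ W (cost true) + (∑ W (cost false) + 0)
        ≡⟨ cong (∑ W (cost true) +_) (+-identityʳ _) ⟩
      ∑ W (cost true) + ∑ W (cost false)
        ≤⟨ cost≤gain ⟩
      ∑ W (gain true) + ∑ W (gain false)
        <⟨ +-mono-<-≤ (more true) (<⇒≤ (more false)) ⟩
      ∑ W (λ t → gain true t + 1) + ∑ W (λ t → gain false t + 1)
        ≡⟨ cong (∑ W (λ t → gain true t + 1) +_) (+-identityʳ _) ⟨
      ∑ W (λ t → gain true t + 1) + (∑ W (λ t → gain false t + 1) + 0) ∎
      where
      more : ∀ c → ∑ W (gain c) < ∑ W (λ t → gain c t + 1)
      more c = begin-strict
        ∑ W (gain c)                       ≡⟨ +-identityʳ _ ⟨
        ∑ W (gain c) + 0                   <⟨ +-monoʳ-< (∑ W (gain c)) 0<W ⟩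
        ∑ W (gain c) + length W            ≡⟨ cong (∑ W (gain c) +_) (trans (∑-const W 1) (*-identityʳ _)) ⟨
        ∑ W (gain c) + ∑ W (λ _ → 1)       ≡⟨ ∑-+ W (gain c) (λ _ → 1) ⟨
        ∑ W (λ t → gain c t + 1)           ∎

-- The hypothesis gives both `16 * n ≤ m` and `16 * k ≤ m * n ^ (d - 1)`. Replacing each `n` in the
-- latter by `m / 16` yields `16 ^ d * k ≤ m ^ d`, and `16 ^ d` dominates `4 * d * 2 ^ d`.
few-rare : ∀ {m n k} d → 0 < n → 16 * (n * n ^ d + n * k) ≤ m * n ^ d → 4 * (d * (2 ^ d * k)) ≤ m ^ d
few-rare zero 0<n h = z≤n
few-rare {m} {n} {k} d@(suc d′) 0<n h = begin
  4 * (d * (2 ^ d * k))     ≡⟨ lemma₁ d (2 ^ d) k ⟩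
  4 * d * (2 ^ d * k)       ≤⟨ *-monoˡ-≤ (2 ^ d * k) (4*d≤8^d d) ⟩
  8 ^ d * (2 ^ d * k)       ≡⟨ trans (sym (*-assoc (8 ^ d) (2 ^ d) k)) (cong (_* k) (sym (^-distribʳ-* 8 2 d))) ⟩
  16 ^ d * k                ≤⟨ *-cancelˡ-≤ n {{n≢0}} scaled ⟩
  m ^ d                     ∎
  where
  open ≤-Reasoning
  instance n≢0 = >-nonZero 0<n
  16n≤m : 16 * n ≤ m
  16n≤m = *-cancelʳ-≤ (16 * n) m (n ^ d) {{m^n≢0 n d}} (begin
    16 * n * n ^ d                 ≡⟨ *-assoc 16 n _ ⟩
    16 * (n * n ^ d)               ≤⟨ *-monoʳ-≤ 16 (m≤m+n (n * n ^ d) (n * k)) ⟩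
    16 * (n * n ^ d + n * k)       ≤⟨ h ⟩
    m * n ^ d                      ∎)
  lemma₁ : ∀ a b c → 4 * (a * (b * c)) ≡ 4 * a * (b * c)
  lemma₁ = solve-∀
  lemma₂ : ∀ a b c → a * (16 * b * c) ≡ b * (16 * (a * c))
  lemma₂ = solve-∀
  lemma₃ : ∀ a b c d → a * (b * (c * d)) ≡ c * (b * (a * d))
  lemma₃ = solve-∀
  scaled : n * (16 ^ d * k) ≤ n * m ^ d
  scaled = begin
    n * (16 ^ d * k)                   ≡⟨ lemma₂ n (16 ^ d′) k ⟩
    16 ^ d′ * (16 * (n * k))           ≤⟨ *-monoʳ-≤ (16 ^ d′) (*-monoʳ-≤ 16 (m≤n+m (n * k) (n * n ^ d))) ⟩
    16 ^ d′ * (16 * (n * n ^ d + n * k)) ≤⟨ *-monoʳ-≤ (16 ^ d′) h ⟩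
    16 ^ d′ * (m * (n * n ^ d′))       ≡⟨ lemma₃ (16 ^ d′) m n (n ^ d′) ⟩
    n * (m * (16 ^ d′ * n ^ d′))       ≡⟨ cong (λ a → n * (m * a)) (^-distribʳ-* 16 n d′) ⟨
    n * (m * (16 * n) ^ d′)            ≤⟨ *-monoʳ-≤ n (*-monoʳ-≤ m (^-monoˡ-≤ d′ 16n≤m)) ⟩
    n * (m * m ^ d′)                   ∎

-- Moving one side of the bipartition.

module Reroute {n N} (Cand : Fin n → Fin N → Set) (Cand? : ∀ w → Decidable (Cand w))
  (enough : ∀ w → n ≤ ∑ (allFin N) (λ y → 𝟙 (Cand? w y))) where

  Used? : ∀ (h : Fin n → Fin N) w y u → Dec (u ≢ w × y ≡ h u)
  Used? h w y u = ¬? (u Fin.≟ w) ×-dec (y Fin.≟ h u)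

  -- Each `u` other than `w` occupies exactly one vertex `h u`, and there are `n - 1` such `u`.
  ∑-used : ∀ h w → (∑[ y ∈ allFin N ] ∑[ u ∈ allFin n ] 𝟙 (Used? h w y u)) < n
  ∑-used h w = begin-strict
    (∑[ y ∈ allFin N ] ∑[ u ∈ allFin n ] 𝟙 (Used? h w y u))
      ≡⟨ ∑-swap (allFin N) (allFin n) _ ⟩
    (∑[ u ∈ allFin n ] ∑[ y ∈ allFin N ] 𝟙 (Used? h w y u))
      ≡⟨ ∑-cong (allFin n) (λ u → ∑-cong (allFin N) λ y →
           𝟙-× (Used? h w y u) (¬? (u Fin.≟ w)) (y Fin.≟ h u) (λ p → p) (λ p → p)) ⟩
    (∑[ u ∈ allFin n ] ∑[ y ∈ allFin N ] 𝟙 (¬? (u Fin.≟ w)) * 𝟙 (y Fin.≟ h u))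
      ≡⟨ ∑-cong (allFin n) (λ u → trans (∑-*ˡ (allFin N) (𝟙 (¬? (u Fin.≟ w))) _)
           (trans (cong (𝟙 (¬? (u Fin.≟ w)) *_) (∑-𝟙-≟ (h u))) (*-identityʳ _))) ⟩
    (∑[ u ∈ allFin n ] 𝟙 (¬? (u Fin.≟ w)))
      <⟨ n<1+n _ ⟩
    suc (∑[ u ∈ allFin n ] 𝟙 (¬? (u Fin.≟ w)))
      ≡⟨ trans (cong (others +_) (∑-𝟙-≟ w)) (+-comm others 1) ⟨
    (∑[ u ∈ allFin n ] 𝟙 (¬? (u Fin.≟ w))) + (∑[ u ∈ allFin n ] 𝟙 (u Fin.≟ w))
      ≡⟨ ∑-+ (allFin n) _ _ ⟨
    (∑[ u ∈ allFin n ] 𝟙 (¬? (u Fin.≟ w)) + 𝟙 (u Fin.≟ w))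
      ≡⟨ ∑-cong (allFin n) (λ u → complement (u Fin.≟ w)) ⟩
    (∑[ u ∈ allFin n ] 1)
      ≡⟨ trans (∑-allFin-const n 1) (*-identityʳ n) ⟩
    n ∎
    where
    open ≤-Reasoning
    others = ∑[ u ∈ allFin n ] 𝟙 (¬? (u Fin.≟ w))
    complement : ∀ (p : Dec P) → 𝟙 (¬? p) + 𝟙 p ≡ 1
    complement (yes _) = refl
    complement (no _)  = refl

  -- Candidates outnumber occupied places, so at some `y` the candidate indicator exceeds the number
  -- of `u` occupying `y`. An indicator is at most 1, hence `y` is a candidate and unoccupied.
  fresh : ∀ h w → ∃ λ y → Cand w y × (∀ u → u ≢ w → y ≢ h u)
  fresh h w =
    let y , lt = ∑-<⇒∃ (allFin N) (<-≤-trans (∑-used h w) (enough w))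
    in y , 𝟙>0⇒ (Cand? w y) (≤-<-trans z≤n lt) , λ u u≢w y≡ → <⇒≱ lt
         (≤-trans (𝟙-≤1 (Cand? w y)) (≤-trans (≤-reflexive (sym (𝟙-yes (Used? h w y u) (u≢w , y≡))))
           (∑-member (λ u → 𝟙 (Used? h w y u)) (∈-allFin u))))

  module _ (f : Fin n → Fin N) (f-injective : Injective _≡_ _≡_ f) (side : Fin n → Bool) where

    -- Each new image avoids the current images of all other vertices, moved or not, so injectivity
    -- survives every step. `Cand` does not depend on the current map, so earlier choices stay
    -- valid.
    reroute : ∀ ws → ∃ λ h → Injective _≡_ _≡_ h × (∀ u → side u ≡ false → h u ≡ f u)
                           × (∀ {w} → w List.∈ ws → side w ≡ true → Cand w (h w))
    reroute [] = f , f-injective , (λ _ _ → refl) , λ ()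
    reroute (w ∷ ws) with side w in eq | reroute ws
    ... | false | h , inj , fixed , ok = h , inj , fixed , λ where
      (Any.here refl) s → case trans (sym eq) s of λ ()
      (Any.there w∈)  s → ok w∈ s
    ... | true | h , inj , fixed , ok with fresh h w
    ... | y , cand , new = h′ , inj′ , fixed′ , ok′
      where
      h′ : Fin n → Fin N
      h′ = Functional.updateAt h w (λ _ → y)
      at : h′ w ≡ y
      at = Functional.updateAt-updates w h
      off : ∀ {u} → u ≢ w → h′ u ≡ h u
      off {u} = Functional.updateAt-minimal u w h
      inj′ : Injective _≡_ _≡_ h′
      inj′ {a} {b} e with a Fin.≟ w | b Fin.≟ w
      ... | yes refl | yes refl = refl
      ... | yes refl | no b≢    = contradiction (trans (sym at) (trans e (off b≢))) (new b b≢)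
      ... | no a≢    | yes refl = contradiction (trans (sym at) (trans (sym e) (off a≢))) (new a a≢)
      ... | no a≢    | no b≢    = inj (trans (sym (off a≢)) (trans e (off b≢)))
      fixed′ : ∀ u → side u ≡ false → h′ u ≡ f u
      fixed′ u s = trans (off λ { refl → case trans (sym eq) s of λ () }) (fixed u s)
      ok′ : ∀ {v} → v List.∈ (w ∷ ws) → side v ≡ true → Cand v (h′ v)
      ok′ {v} v∈ s with v Fin.≟ w | v∈
      ... | yes refl | _              = subst (Cand w) (sym at) cand
      ... | no v≢w   | Any.here v≡w   = contradiction v≡w v≢w
      ... | no v≢w   | Any.there v∈ws = subst (Cand v) (sym (off v≢w)) (ok v∈ws s)

-- Neighbourhoods in `H` as hyperedges.

degree≤maxDegree : ∀ (H : Graph n) v → degree H v ≤ maxDegree H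
degree≤maxDegree {n} H v = go (∈-allFin v)
  where
  go : ∀ {vs} → v List.∈ vs → degree H v ≤ foldr _⊔_ 0 (map (degree H) vs)
  go (Any.here refl) = m≤m⊔n _ _
  go (Any.there v∈)  = ≤-trans (go v∈) (m≤n⊔m _ _)

neighbourhood : Graph n → Fin n → Subset n
neighbourhood H w = tabulate (adj H w)

∈-neighbourhood⁺ : ∀ (H : Graph n) {u w} → adj H w u ≡ true → u ∈ neighbourhood H w
∈-neighbourhood⁺ H {u} {w} e = Vec.lookup⇒[]= u _ (trans (Vec.lookup∘tabulate (adj H w) u) e)

∈-neighbourhood⁻ : ∀ (H : Graph n) {u w} → u ∈ neighbourhood H w → adj H w u ≡ true
∈-neighbourhood⁻ H {u} {w} u∈ = trans (sym (Vec.lookup∘tabulate (adj H w) u)) (Vec.[]=⇒lookup u∈)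

∣tabulate∣ : ∀ (f : Fin n → Bool) → ∣ tabulate f ∣ ≡ ∑ (allFin n) (λ v → if f v then 1 else 0)
∣tabulate∣ {zero}  f = refl
∣tabulate∣ {suc n} f = trans head (sym (∑-allFin-suc λ v → if f v then 1 else 0))
  where
  head : ∣ tabulate f ∣ ≡ (if f zero then 1 else 0) + ∑ (allFin n) (λ v → if f (suc v) then 1 else 0)
  head with f zero
  ... | true  = cong suc (∣tabulate∣ (f ∘ suc))
  ... | false = ∣tabulate∣ (f ∘ suc)

∣neighbourhood∣≤ : ∀ (H : Graph n) w → ∣ neighbourhood H w ∣ ≤ maxDegree H
∣neighbourhood∣≤ H w = ≤-trans (≤-reflexive (∣tabulate∣ (adj H w))) (degree≤maxDegree H w)

-- By symmetry of `adj`, the hyperedges through `v` are the neighbourhoods of the neighbours of `v`.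
∑-incident-≤ : ∀ (H : Graph n) v → (∑[ w ∈ allFin n ] 𝟙 (v ∈? neighbourhood H w)) ≤ maxDegree H
∑-incident-≤ {n} H v = ≤-trans
  (∑-mono (allFin n) λ w → 𝟙-≤ (v ∈? neighbourhood H w) λ v∈ →
    ≤-reflexive (cong (λ b → if b then 1 else 0) (sym (trans (adj-sym H v w) (∈-neighbourhood⁻ H v∈)))))
  (degree≤maxDegree H v)

-- Embedding `H` into one colour.

module Embedding {n N} (H : Graph n) (χ : Fin N → Fin N → Bool) where

  D : ℕ
  D = maxDegree H

  open DependentRandomChoice χ n D

  Rich : Bool → Vec (Fin N) n → Set
  Rich c f = ∀ w → n ≤ common c (select (neighbourhood H w) f)

  -- The counting argument with neighbourhoods as hyperedges and `Few c` as the property to avoid.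
  -- All of `V(H)` is mapped into `L`, on both sides of the bipartition.
  ∃-rich : 0 < n → N ≡ 2 ^ (D + 6) * n → ∀ c t →
    16 * (n * n ^ D + n * few c t) ≤ length (nbrs c t) * n ^ D →
    ∃ λ f → Injective _≡_ _≡_ (lookup f) × Rich c f
  ∃-rich 0<n N≡ c t choice = case good of λ (f , distinct , ¬few) →
    f , (λ {u} {v} → injective f distinct u v) , λ w → ≮⇒≥ (¬few w (λ _ → ∈⊤))
    where
    instance
      n≢0 : NonZero n
      n≢0 = >-nonZero 0<n

    L : List (Fin N)
    L = nbrs c t

    open Counting L (neighbourhood H) D (Few? c) using (Good; ∃-good)

    16n≤∣L∣ : 16 * n ≤ length L
    16n≤∣L∣ = *-cancelʳ-≤ (16 * n) (length L) (n ^ D) {{m^n≢0 n D}} (≤-trans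
      (≤-trans (≤-reflexive (*-assoc 16 n (n ^ D))) (*-monoʳ-≤ 16 (m≤m+n (n * n ^ D) (n * few c t)))) choice)

    L-unique : ∀ z → ∑ L (λ x → 𝟙 (x Fin.≟ z)) ≤ 1
    L-unique z = begin
      ∑ L (λ x → 𝟙 (x Fin.≟ z))                     ≡⟨ ∑-filter (Nbr? c t) X _ ⟩
      ∑ X (λ x → 𝟙 (Nbr? c t x) * 𝟙 (x Fin.≟ z))    ≤⟨ ∑-mono X (λ x → *-monoˡ-≤ (𝟙 (x Fin.≟ z)) (𝟙-≤1 (Nbr? c t x))) ⟩
      ∑ X (λ x → 1 * 𝟙 (x Fin.≟ z))                 ≡⟨ ∑-cong X (λ x → *-identityˡ _) ⟩
      ∑ X (λ x → 𝟙 (x Fin.≟ z))                     ≡⟨ ∑-𝟙-≟ z ⟩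
      1                                             ∎
      where open ≤-Reasoning

    -- Every vertex of `K_N` is vacuously a common neighbour of the empty tuple, and `N` is at least
    -- `n`.
    ¬few-[] : ¬ Few c []
    ¬few-[] lt = <⇒≱ lt (≤-trans (m≤n*m n (2 ^ (D + 6)) {{m^n≢0 2 (D + 6)}}) (≤-reflexive
      (sym (trans (trans (∑-allFin-const N 1) (*-identityʳ N)) N≡))))

    good : ∃ λ f → Good ⊤ f
    good = ∃-good {{>-nonZero (≤-trans (≤-trans 0<n (m≤n*m n 16)) 16n≤∣L∣)}}
      (λ xs ys → ≤-<-trans (common-++ c xs ys))
      (∣neighbourhood∣≤ H) L-unique (∑-incident-≤ H)
      (≤-trans (*-monoˡ-≤ n (m≤m+n 4 12)) 16n≤∣L∣)
      (few-rare D 0<n choice) ¬few-[]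

    injective : ∀ f → (∀ u v → u ∈ ⊤ → v ∈ ⊤ → u ≢ v → lookup f u ≢ lookup f v) →
      ∀ u v → lookup f u ≡ lookup f v → u ≡ v
    injective f distinct u v e with u Fin.≟ v
    ... | yes u≡v = u≡v
    ... | no u≢v  = contradiction e (distinct u v ∈⊤ ∈⊤ u≢v)

  -- The neighbours of a vertex on the `true` side all lie on the `false` side, where `h` still
  -- equals `f`. A common neighbour of their images under `f` is therefore joined in colour `c` to
  -- their final images.
  embed : Bipartite H → (∀ i j → χ i j ≡ χ j i) → ∀ c f → Injective _≡_ _≡_ (lookup f) → Rich c f → MonoCopy H χ c
  embed (side , proper) χ-sym c f f-injective rich = case reroute (lookup f) f-injective side (allFin n) of
    λ (h , h-injective , fixed , cand) → h , (λ {u} {v} → h-injective {u} {v}) , edge h fixed (λ w → cand (∈-allFin w))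
    where
    Cand : Fin n → Fin N → Set
    Cand w y = All (λ x → χ x y ≡ c) (select (neighbourhood H w) f)

    open Reroute Cand (λ w y → All.all? (λ x → Adj? c x y) (select (neighbourhood H w) f)) rich

    module _ (h : Fin n → Fin N) (fixed : ∀ u → side u ≡ false → h u ≡ lookup f u)
      (cand : ∀ w → side w ≡ true → Cand w (h w)) where

      oriented : ∀ u w → side u ≡ false → side w ≡ true → adj H w u ≡ true → χ (h u) (h w) ≡ c
      oriented u w su sw e = subst (λ x → χ x (h w) ≡ c) (sym (fixed u su))
        (All.lookup (cand w sw) (lookup∈select f (∈-neighbourhood⁺ H e)))

      edge : ∀ u v → adj H u v ≡ true → χ (h u) (h v) ≡ c
      edge u v e with side u in su | side v in sv
      ... | false | true  = oriented u v su sv (trans (adj-sym H v u) e)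
      ... | true  | false = trans (χ-sym (h u) (h v)) (oriented v u sv su e)
      ... | false | false = contradiction (trans su (sym sv)) (proper u v e)
      ... | true  | true  = contradiction (trans su (sym sv)) (proper u v e)

  arrows : 0 < n → N ≡ 2 ^ (D + 6) * n → Bipartite H → (∀ i j → χ i j ≡ χ j i) →
    ∃ λ c → MonoCopy H χ c
  arrows 0<n N≡ bip χ-sym =
    case ∃-choice N≡ 0<n of λ (c , t , choice) →
    case ∃-rich 0<n N≡ c t choice of λ (f , f-injective , rich) →
    c , embed bip χ-sym c f f-injective rich

theorem4p1 : (n : ℕ) (H : Graph n) → Bipartite H →
    Arrows (2 ^ (maxDegree H + 6) * n) H
-- Without vertices the empty map is already a copy; the case is split off because the averaging
-- assumes `0 < n`.
theorem4p1 zero      H _   _           = true , (λ ()) , (λ {}) , λ ()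
theorem4p1 n@(suc _) H bip (χ , χ-sym) = Embedding.arrows H χ (s≤s z≤n) refl bip χ-sym
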